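{- Let $\mathcal{B}$ be a swap structure for $\mathbf{Ci}$. Then there exist a set $I$ and a monomorphism of multialgebras $\hat h:\mathcal{B}\to\prod_{i\in I}\mathcal{B}_{\mathbb{A}_2}^{\mathbf{Ci}}$.
   Context: Let $\Sigma=\{\wedge,\vee,\to,\neg,\circ\}$, with $\wedge,\vee,\to$ binary and $\neg,\circ$ unary. A multialgebra over $\Sigma$ is a nonempty set $B$ with, for each $n$-ary symbol $c$, a function $c^{\mathcal{B}}:B^n\to\wp(B)\setminus\{\emptyset\}$. A homomorphism $f:\mathcal{A}\to\mathcal{B}$ is a function between the domains with $f[c^{\mathcal{A}}(\vec a)]\subseteq c^{\mathcal{B}}(f(\vec a))$ for all $c$ and $\vec a$. These form the category $\mathbf{MAlg}(\Sigma)$; a monomorphism of multialgebras is a monomorphism in this category. The product $\prod_{i\in I}\mathcal{A}_i$ has as domain the cartesian product of the domains and multioperations $c(\vec a)=\prod_{i\in I}c^{\mathcal{A}_i}(\pi_i(\vec a))$ (for $I=\emptyset$ it is the one-element multialgebra). For a Boolean algebra $\mathcal{A}$ with domain $A$ (the one-element Boolean algebra is allowed) and $z\in A^3$ write $z=(z_1,z_2,z_3)$; $\sim$ is Boolean complement. Put $\mathrm{B}_{\mathcal{A}}^{\mathbf{ciw}}=\{z\in A^3 : z_1\vee z_2=1 \text{ and } z_3={\sim}(z_1\wedge z_2)\}$. A swap structure for $\mathbf{Ci}$ over $\mathcal{A}$ is a multialgebra $\mathcal{B}$ over $\Sigma$ with domain $B\subseteq \mathrm{B}_{\mathcal{A}}^{\mathbf{ciw}}$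 such that $0\in\{z_1: z\in B\}$ and for all $z,w\in B$: (i) $\emptyset\ne z\#w\subseteq\{u\in B: u_1=z_1\# w_1\}$ for $\#\in\{\wedge,\vee,\to\}$; (ii) $\emptyset\neq\neg z\subseteq\{u\in B:u_1=z_2 \text{ and } u_2\le z_1\}$; (iii) $\circ z=\{({\sim}(z_1\wedge z_2),z_1\wedge z_2,1)\}$. A swap structure for $\mathbf{Ci}$ is one over some Boolean algebra. The full swap structure $\mathcal{B}_{\mathcal{A}}^{\mathbf{Ci}}$ has domain $\mathrm{B}_{\mathcal{A}}^{\mathbf{ciw}}$ and equality in the right-hand inclusions of (i)–(ii), with (iii) unchanged. $\mathbb{A}_2$ is the two-element Boolean algebra. -}

module Defs where

open import Level using (Level; _⊔_; suc; 0ℓ)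
open import Data.Nat.Base using (ℕ)
open import Data.Product using (Σ; ∃; _×_; _,_; proj₁; proj₂)
open import Data.Product.Relation.Binary.Pointwise.NonDependent using (_×ₛ_)
open import Data.Vec.Base using (Vec; []; _∷_; map)
open import Data.Vec.Relation.Binary.Pointwise.Inductive as Pointwise
  using (Pointwise; []; _∷_)
open import Data.Bool.Properties using (∨-∧-booleanAlgebra)
open import Relation.Unary using (Pred; _⊆_)
open import Relation.Binary.Bundles using (Setoid; Poset)
open import Relation.Binary.Definitions using (_Respects_)
import Relation.Binary.Construct.On as On
open import Function.Bundles using (Func)
open import Function.Construct.Composition using (function)
open import Algebra.Lattice.Bundles using (BooleanAlgebra)
import Algebra.Lattice.Properties.Lattice as LatticeProperties
import Algebra.Lattice.Properties.BooleanAlgebra as BooleanAlgebraProperties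

-- Sets are rendered as setoids, so subsets and multioperations are required
-- to respect _≈_.

-- The axiom of choice of the classical metatheory: a total relation between
-- sets contains a function.  The function has to respect _≈_; this is what
-- makes the principle non-trivial in type theory, and it implies excluded
-- middle (Diaconescu).
AxiomOfChoice : (ℓ : Level) → Set (suc ℓ)
AxiomOfChoice ℓ =
  (X Y : Setoid ℓ ℓ) →
  let module X = Setoid X
      module Y = Setoid Y in
  (R : X.Carrier → Y.Carrier → Set ℓ) →
  (∀ {x x′ y y′} → x X.≈ x′ → y Y.≈ y′ → R x y → R x′ y′) →
  (∀ x → ∃ λ y → R x y) →
  Σ (Func X Y) λ f → ∀ x → R x (Func.to f x)

data Connective : Set where
  and or imp neg circ : Connective

arity : Connective → ℕ
arity and  = 2
arity or   = 2
arity imp  = 2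
arity neg  = 1
arity circ = 1

record Multioperations {ℓ} (S : Setoid ℓ ℓ) : Set (suc ℓ) where
  open Setoid S
  field
    op          : ∀ c → Vec Carrier (arity c) → Pred Carrier ℓ
    op-resp     : ∀ c {as bs x y} → Pointwise _≈_ as bs → x ≈ y →
                  op c as x → op c bs y
    op-nonempty : ∀ c as → ∃ λ x → op c as x

record Multialgebra (ℓ : Level) : Set (suc ℓ) where
  field
    setoid          : Setoid ℓ ℓ
    nonempty        : Setoid.Carrier setoid
    multioperations : Multioperations setoid
  open Setoid setoid public using (Carrier; _≈_)
  open Multioperations multioperations public

record Hom {a b} (A : Multialgebra a) (B : Multialgebra b) : Set (a ⊔ b) where
  private
    module A = Multialgebra A
    module B = Multialgebra B
  field
    func : Func A.setoid B.setoid
  open Func func public using (to; cong)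
  field
    preserves : ∀ c as {x} → A.op c as x → B.op c (map to as) (to x)

infixr 9 _∘ₕ_
infix  4 _≈ₕ_

_≈ₕ_ : ∀ {a b} {A : Multialgebra a} {B : Multialgebra b} →
       Hom A B → Hom A B → Set (a ⊔ b)
_≈ₕ_ {B = B} f g = ∀ x → Multialgebra._≈_ B (Hom.to f x) (Hom.to g x)

_∘ₕ_ : ∀ {a b c} {A : Multialgebra a} {B : Multialgebra b} {C : Multialgebra c} →
       Hom B C → Hom A B → Hom A C
_∘ₕ_ {B = B} {C = C} g f = record
  { func      = function (Hom.func f) (Hom.func g)
  ; preserves = λ c as x∈ →
      Multialgebra.op-resp C c (map-∘ as) C.refl
        (Hom.preserves g c _ (Hom.preserves f c as x∈))
  }
  where
  module C = Setoid (Multialgebra.setoid C)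
  map-∘ : ∀ {n} (as : Vec _ n) →
    Pointwise C._≈_ (map (Hom.to g) (map (Hom.to f) as))
                    (map (λ x → Hom.to g (Hom.to f x)) as)
  map-∘ []       = []
  map-∘ (a ∷ as) = C.refl ∷ map-∘ as

-- Monomorphisms of the category of multialgebras (over sets of size ℓ).
IsMono : ∀ {ℓ} {A B : Multialgebra ℓ} → Hom A B → Set (suc ℓ)
IsMono {ℓ} {A} f =
  ∀ {C : Multialgebra ℓ} (g h : Hom C A) → f ∘ₕ g ≈ₕ f ∘ₕ h → g ≈ₕ h

∏ : ∀ {i ℓ} (I : Set i) → (I → Multialgebra ℓ) → Multialgebra (i ⊔ ℓ)
∏ I M = record
  { setoid   = record
    { Carrier       = ∀ i → M.Carrier i
    ; _≈_           = λ x y → ∀ i → M._≈_ i (x i) (y i)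
    ; isEquivalence = record
      { refl  = λ i → Setoid.refl (M.setoid i)
      ; sym   = λ p i → Setoid.sym (M.setoid i) (p i)
      ; trans = λ p q i → Setoid.trans (M.setoid i) (p i) (q i)
      }
    }
  ; nonempty = λ i → M.nonempty i
  ; multioperations = record
    { op          = λ c as x → ∀ i → M.op i c (map (λ a → a i) as) (x i)
    ; op-resp     = λ c as≈bs x≈y x∈ i →
        M.op-resp i c (Pointwise.map⁺ (λ p → p i) as≈bs) (x≈y i) (x∈ i)
    ; op-nonempty = λ c as →
        (λ i → proj₁ (M.op-nonempty i c (map (λ a → a i) as))) ,
        (λ i → proj₂ (M.op-nonempty i c (map (λ a → a i) as)))
    }
  }
  where module M i = Multialgebra (M i)

module Swap {ℓ} (𝓐 : BooleanAlgebra ℓ ℓ) where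
  open BooleanAlgebra 𝓐
  open BooleanAlgebraProperties 𝓐
    using (¬-involutive; ∧-identityʳ; ∨-zeroʳ; ¬⊥≈⊤)
  open Poset (LatticeProperties.poset lattice) using (_≤_; ≤-respʳ-≈; ≤-respˡ-≈)
    renaming (refl to ≤-refl)

  infixr 5 _⇒_
  _⇒_ : Carrier → Carrier → Carrier
  x ⇒ y = ¬ x ∨ y

  tripleSetoid : Setoid ℓ ℓ
  tripleSetoid = setoid ×ₛ (setoid ×ₛ setoid)

  open Setoid tripleSetoid public using ()
    renaming (Carrier to Triple; _≈_ to _≈₃_)

  infix 10 _₁ _₂ _₃
  _₁ _₂ _₃ : Triple → Carrier
  z ₁ = proj₁ z
  z ₂ = proj₁ (proj₂ z)
  z ₃ = proj₂ (proj₂ z)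

  Bciw : Pred Triple ℓ
  Bciw z = (z ₁ ∨ z ₂ ≈ ⊤) × (z ₃ ≈ ¬ (z ₁ ∧ z ₂))

  -- The subsets of A³ bounding the multioperations of a swap structure.
  Bound : ∀ c → Vec Triple (arity c) → Pred Triple ℓ
  Bound and  (z ∷ w ∷ []) u = u ₁ ≈ z ₁ ∧ w ₁
  Bound or   (z ∷ w ∷ []) u = u ₁ ≈ z ₁ ∨ w ₁
  Bound imp  (z ∷ w ∷ []) u = u ₁ ≈ (z ₁ ⇒ w ₁)
  Bound neg  (z ∷ [])     u = (u ₁ ≈ z ₂) × (u ₂ ≤ z ₁)
  Bound circ (z ∷ [])     u = u ≈₃ (¬ (z ₁ ∧ z ₂) , z ₁ ∧ z ₂ , ⊤)

  subsetSetoid : Pred Triple ℓ → Setoid ℓ ℓ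
  subsetSetoid D = On.setoid {B = Σ Triple D} tripleSetoid proj₁

  -- The clause for circ is an equality of sets: op⊆ and circ-⊇ are its two
  -- inclusions.
  record SwapStructure : Set (suc ℓ) where
    field
      Domain          : Pred Triple ℓ
      Domain-resp     : Domain Respects _≈₃_
      Domain⊆Bciw     : Domain ⊆ Bciw
      multioperations : Multioperations (subsetSetoid Domain)
    open Multioperations multioperations public
    field
      zero∈   : ∃ λ z → Domain z × z ₁ ≈ ⊥
      op⊆     : ∀ c zs {u} → op c zs u → Bound c (map proj₁ zs) (proj₁ u)
      circ-⊇  : ∀ zs {u} → Bound circ (map proj₁ zs) (proj₁ u) → op circ zs u

    multialgebra : Multialgebra ℓ
    multialgebra = record
      { setoid          = subsetSetoid Domain
      ; nonempty        = proj₁ zero∈ , proj₁ (proj₂ zero∈)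
      ; multioperations = multioperations
      }

  Bciw-resp : Bciw Respects _≈₃_
  Bciw-resp (p , q , r) (e , f) =
    trans (sym (∨-cong p q)) e ,
    trans (sym r) (trans f (¬-cong (∧-cong p q)))

  Bound-resp : ∀ c {zs ws u v} → Pointwise _≈₃_ zs ws → u ≈₃ v →
               Bound c zs u → Bound c ws v
  Bound-resp and  ((p , _) ∷ (q , _) ∷ []) (e , _) b =
    trans (sym e) (trans b (∧-cong p q))
  Bound-resp or   ((p , _) ∷ (q , _) ∷ []) (e , _) b =
    trans (sym e) (trans b (∨-cong p q))
  Bound-resp imp  ((p , _) ∷ (q , _) ∷ []) (e , _) b =
    trans (sym e) (trans b (∨-cong (¬-cong p) q))
  Bound-resp neg  ((p , q , _) ∷ []) (e , f , _) (b , b′) =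
    trans (sym e) (trans b q) , ≤-respʳ-≈ p (≤-respˡ-≈ f b′)
  Bound-resp circ ((p , q , _) ∷ []) (e , f , g) (b , b′ , b″) =
    trans (sym e) (trans b (¬-cong (∧-cong p q))) ,
    trans (sym f) (trans b′ (∧-cong p q)) ,
    trans (sym g) b″

  private
    withFirst : ∀ a → Σ (Σ Triple Bciw) λ u → proj₁ u ₁ ≈ a
    withFirst a = ((a , ⊤ , ¬ (a ∧ ⊤)) , ∨-zeroʳ a , refl) , refl

  Bound-nonempty : ∀ c (zs : Vec (Σ Triple Bciw) (arity c)) →
    ∃ λ (u : Σ Triple Bciw) → Bound c (map proj₁ zs) (proj₁ u)
  Bound-nonempty and  (z ∷ w ∷ []) = withFirst _
  Bound-nonempty or   (z ∷ w ∷ []) = withFirst _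
  Bound-nonempty imp  (z ∷ w ∷ []) = withFirst _
  Bound-nonempty neg  ((z , e , _) ∷ []) =
    ((z ₂ , z ₁ , ¬ (z ₂ ∧ z ₁)) , trans (∨-comm _ _) e , refl) , refl , ≤-refl
  Bound-nonempty circ ((z , _) ∷ []) =
    ( (¬ (z ₁ ∧ z ₂) , z ₁ ∧ z ₂ , ⊤)
    , ∨-complementˡ _
    , trans (sym ¬⊥≈⊤) (¬-cong (sym (∧-complementˡ _)))
    ) , refl , refl , refl

  fullSwapStructure : SwapStructure
  fullSwapStructure = record
    { Domain          = Bciw
    ; Domain-resp     = Bciw-resp
    ; Domain⊆Bciw     = λ b → b
    ; multioperations = record
      { op          = λ c zs u → Bound c (map proj₁ zs) (proj₁ u)
      ; op-resp     = λ c zs≈ws u≈v → Bound-resp c (Pointwise.map⁺ (λ p → p) zs≈ws) u≈v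
      ; op-nonempty = Bound-nonempty
      }
    ; zero∈           = _ , proj₂ (proj₁ (withFirst ⊥)) , refl
    ; op⊆             = λ c zs b → b
    ; circ-⊇          = λ zs b → b
    }

open Swap public using (SwapStructure; fullSwapStructure)
open Swap.SwapStructure public using (multialgebra)

𝔸₂ : BooleanAlgebra 0ℓ 0ℓ
𝔸₂ = ∨-∧-booleanAlgebra

{-# OPTIONS --safe #-}

-- The homomorphisms from a Boolean algebra 𝓐 to 𝔸₂ separate its elements
-- (Boolean prime ideal theorem), and each of them acts coordinatewise as a
-- homomorphism from a swap structure over 𝓐 to the full swap structure
-- over 𝔸₂.  Taking I to be the set of all of them gives an injective, hence
-- monic, ĥ.
--
-- Choice yields excluded middle (Diaconescu), so that functions to Bool are
-- the subsets of a set at its own universe level.  Choice also yields Zorn's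
-- lemma, through the tower generated by a chosen extension map and suprema
-- of chains.  A maximal proper filter is then the truth set of a
-- homomorphism to 𝔸₂.

module Submission where

open import Defs
open import Level using (Lift; lift)
open import Data.Bool.Base as Bool using (Bool; true; false; T; not)
open import Data.Bool.Properties using (T-∧; T-≡; ⇔→≡; not-involutive)
open import Data.Empty using (⊥-elim)
open import Data.Product using (Σ; ∃; _×_; _,_; proj₁; proj₂)
open import Data.Sum.Base using (_⊎_; inj₁; inj₂; [_,_]′)
import Data.Sum.Base as Sum
open import Data.Vec.Base using (Vec; []; _∷_; map)
open import Data.Vec.Properties using (map-∘)
open import Algebra.Lattice.Bundles using (BooleanAlgebra)
import Algebra.Lattice.Properties.Lattice as LatticeProperties
import Algebra.Lattice.Properties.BooleanAlgebra as BooleanAlgebraProperties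
open import Axiom.ExcludedMiddle using (ExcludedMiddle)
open import Function.Base using (_∘_; id; case_of_)
open import Function.Bundles using (Func; mk⇔; module Equivalence)
open import Relation.Binary.Bundles using (Setoid; Poset)
import Relation.Binary.Construct.Interior.Symmetric as SymInterior
import Relation.Binary.Lattice.Bundles as OrderLattice
open import Relation.Binary.PropositionalEquality as ≡ using (_≡_)
open import Relation.Nullary using (yes; no)
import Relation.Nullary as Nullary
open import Relation.Nullary.Decidable using (isYes; decidable-stable; toWitness; fromWitness)

-- Excluded middle from choice

choice⇒excludedMiddle : ∀ {ℓ} → AxiomOfChoice ℓ → ExcludedMiddle ℓ
choice⇒excludedMiddle {ℓ} choice {P}
  with choice quotient discrete _∼_ respects (λ (lift x) → lift x , inj₁ ≡.refl)
  where
  -- Serves both as the equality of the domain and as the relation from which a function is chosen.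
  _∼_ : Lift ℓ Bool → Lift ℓ Bool → Set ℓ
  lift x ∼ lift y = x ≡ y ⊎ P

  ∼-trans : ∀ {x y z} → x ∼ y → y ∼ z → x ∼ z
  ∼-trans (inj₁ ≡.refl) q = q
  ∼-trans (inj₂ p)      _ = inj₂ p

  ∼-sym : ∀ {x y} → x ∼ y → y ∼ x
  ∼-sym = Sum.map₁ ≡.sym

  quotient discrete : Setoid ℓ ℓ
  quotient = record
    { _≈_           = _∼_
    ; isEquivalence = record
      { refl = inj₁ ≡.refl ; sym = ∼-sym ; trans = ∼-trans }
    }
  discrete = ≡.setoid (Lift ℓ Bool)

  respects : ∀ {x x′ y y′} → x ∼ x′ → y ≡ y′ → x ∼ y → x′ ∼ y′
  respects x∼x′ ≡.refl x∼y = ∼-trans (∼-sym x∼x′) x∼y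
... | f , x∼fx with Func.to f (lift true) in eqₜ | Func.to f (lift false) in eqf
                  | x∼fx (lift true) | x∼fx (lift false)
... | _          | _          | inj₂ p      | _           = yes p
... | _          | _          | _           | inj₂ p      = yes p
-- Each boolean is its own chosen value here. A proof of `P` would identify the two arguments, hence
-- the two values.
... | lift true  | lift false | inj₁ ≡.refl | inj₁ ≡.refl = no λ p →
  case ≡.trans (≡.sym eqₜ) (≡.trans (Func.cong f (inj₂ p)) eqf) of λ ()

-- Zorn's lemma

module Zorn {ℓ} (choice : AxiomOfChoice ℓ) (P : Poset ℓ ℓ ℓ) where
  open Poset P
  private
    em : ExcludedMiddle ℓ
    em = choice⇒excludedMiddle choice

  IsChain : (Carrier → Bool) → Set ℓ
  IsChain D = ∀ x y → T (D x) → T (D y) → x ≤ y ⊎ y ≤ x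

  record Supremum (D : Carrier → Bool) : Set ℓ where
    field
      sup   : Carrier
      upper : ∀ {x} → T (D x) → x ≤ sup
      least : ∀ {z} → (∀ {x} → T (D x) → x ≤ z) → sup ≤ z

  ChainComplete : Set ℓ
  ChainComplete = ∀ D → IsChain D → Supremum D

  Maximal : Carrier → Set ℓ
  Maximal x = ∀ y → x ≤ y → y ≤ x

  module BourbakiWitt (complete : ChainComplete)
    (next : Carrier → Carrier) (next-cong : ∀ {x y} → x ≈ y → next x ≈ next y)
    (next-ext : ∀ x → x ≤ next x) where

    -- The empty chain in `limit` supplies the starting point. That `D` is a chain is demanded,
    -- since comparability is proved only afterwards, by induction on this type.
    data Tower : Carrier → Set ℓ where
      limit : ∀ D (chain : IsChain D) → (∀ {x} → T (D x) → Tower x) →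
              Tower (Supremum.sup (complete D chain))
      succ  : ∀ {x} → Tower x → Tower (next x)

    -- Stronger than order comparability, as `next` is inflationary: `x` is not strictly between `y`
    -- and `next y`.
    Comparable : Carrier → Carrier → Set ℓ
    Comparable x y = x ≤ y ⊎ next y ≤ x

    comparable-limit : ∀ D chain {y} → (∀ {x} → T (D x) → Comparable x y) →
                       Comparable (Supremum.sup (complete D chain)) y
    comparable-limit D chain {y} ih with em {∃ λ x → T (D x) × next y ≤ x}
    ... | yes (x , x∈D , y⁺≤x) = inj₂ (trans y⁺≤x (upper x∈D))
      where open Supremum (complete D chain)
    ... | no none = inj₁ (least λ x∈D →
            [ id , (λ y⁺≤x → ⊥-elim (none (_ , x∈D , y⁺≤x))) ]′ (ih x∈D))
      where open Supremum (complete D chain)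

    comparable-succ : ∀ {x y} → Comparable x y → Comparable y x →
                      Comparable (next x) y
    -- Antisymmetry makes `x` and `y` equal; this is where `next` has to respect equality.
    comparable-succ (inj₁ x≤y)  (inj₁ y≤x)  =
      inj₂ (reflexive (next-cong (antisym y≤x x≤y)))
    comparable-succ (inj₁ _)    (inj₂ x⁺≤y) = inj₁ x⁺≤y
    comparable-succ (inj₂ y⁺≤x) _           = inj₂ (trans y⁺≤x (next-ext _))

    -- Double induction. For `next x`, the inner induction `converse` compares every tower element
    -- with `x`, using the outer hypothesis on `x` in its own successor case.
    comparable : ∀ {x y} → Tower x → Tower y → Comparable x y
    comparable (limit D chain ts) u = comparable-limit D chain λ x∈D →
      comparable (ts x∈D) u
    comparable {y = y} (succ {x} t) u = comparable-succ (comparable t u) (converse u)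
      where
      converse : ∀ {y} → Tower y → Comparable y x
      converse (limit D chain us) = comparable-limit D chain λ y∈D →
        converse (us y∈D)
      converse (succ u′) = comparable-succ (converse u′) (comparable t u′)

    fixedPoint : ∃ λ x → next x ≤ x
    -- The tower is a chain, so its supremum lies in it, and so does the successor of that supremum.
    fixedPoint = sup , upper (fromWitness (succ (limit all chain toWitness)))
      where
      all : Carrier → Bool
      all x = isYes (em {Tower x})

      chain : IsChain all
      chain _ _ x∈ y∈ with comparable (toWitness x∈) (toWitness y∈)
      ... | inj₁ x≤y  = inj₁ x≤y
      ... | inj₂ y⁺≤x = inj₂ (trans (next-ext _) y⁺≤x)

      open Supremum (complete all chain)

  -- Total by excluded middle, so choice turns it into an extension map whose fixed points are
  -- maximal.
  Improves : Carrier → Carrier → Set ℓ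
  Improves x y = x ≤ y × (y ≤ x → Maximal x)

  improvement : ∀ x → ∃ (Improves x)
  improvement x with em {∃ λ y → x ≤ y × Nullary.¬ (y ≤ x)}
  ... | yes (y , x≤y , y≰x) = y , x≤y , ⊥-elim ∘ y≰x
  ... | no none             = x , refl , λ _ y x≤y →
    decidable-stable em λ y≰x → none (y , x≤y , y≰x)

  Improves-resp : ∀ {x x′ y y′} → x ≈ x′ → y ≈ y′ → Improves x y → Improves x′ y′
  Improves-resp x≈x′ y≈y′ (x≤y , maximal) =
    trans (reflexive (Eq.sym x≈x′)) (trans x≤y (reflexive y≈y′)) ,
    λ y′≤x′ z x′≤z → trans
      (maximal (trans (reflexive y≈y′) (trans y′≤x′ (reflexive (Eq.sym x≈x′)))) z
               (trans (reflexive x≈x′) x′≤z))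
      (reflexive x≈x′)

  zorn : ChainComplete → ∃ Maximal
  zorn complete with choice Eq.setoid Eq.setoid Improves Improves-resp improvement
  ... | next , improves = x , proj₂ (improves x) x⁺≤x
    where
    open BourbakiWitt complete (Func.to next) (Func.cong next) (proj₁ ∘ improves)
    x    = proj₁ fixedPoint
    x⁺≤x = proj₂ fixedPoint

-- Homomorphisms to the two-element Boolean algebra

record BooleanHom {ℓ} (𝓐 : BooleanAlgebra ℓ ℓ) : Set ℓ where
  open BooleanAlgebra 𝓐
  open BooleanAlgebraProperties 𝓐 using (¬-involutive; deMorgan₂)
  private module 𝟚 = BooleanAlgebraProperties 𝔸₂
  field
    ⟦_⟧    : Carrier → Bool
    ⟦⟧-cong : ∀ {x y} → x ≈ y → ⟦ x ⟧ ≡ ⟦ y ⟧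
    ∧-homo : ∀ x y → ⟦ x ∧ y ⟧ ≡ ⟦ x ⟧ Bool.∧ ⟦ y ⟧
    ¬-homo : ∀ x → ⟦ ¬ x ⟧ ≡ not ⟦ x ⟧

  ∨-homo : ∀ x y → ⟦ x ∨ y ⟧ ≡ ⟦ x ⟧ Bool.∨ ⟦ y ⟧
  ∨-homo x y = begin
    ⟦ x ∨ y ⟧                          ≡⟨ not-involutive _ ⟨
    not (not ⟦ x ∨ y ⟧)                ≡⟨ ≡.cong not (¬-homo (x ∨ y)) ⟨
    not ⟦ ¬ (x ∨ y) ⟧                  ≡⟨ ≡.cong not (⟦⟧-cong (deMorgan₂ x y)) ⟩
    not ⟦ ¬ x ∧ ¬ y ⟧                  ≡⟨ ≡.cong not (∧-homo (¬ x) (¬ y)) ⟩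
    not (⟦ ¬ x ⟧ Bool.∧ ⟦ ¬ y ⟧)       ≡⟨ 𝟚.deMorgan₁ ⟦ ¬ x ⟧ ⟦ ¬ y ⟧ ⟩
    not ⟦ ¬ x ⟧ Bool.∨ not ⟦ ¬ y ⟧     ≡⟨ ≡.cong₂ Bool._∨_ (not-¬ x) (not-¬ y) ⟩
    ⟦ x ⟧ Bool.∨ ⟦ y ⟧                 ∎
    where
    open ≡.≡-Reasoning
    not-¬ : ∀ z → not ⟦ ¬ z ⟧ ≡ ⟦ z ⟧
    not-¬ z = ≡.trans (≡.sym (¬-homo (¬ z))) (⟦⟧-cong (¬-involutive z))

  ⊤-homo : ⟦ ⊤ ⟧ ≡ true
  ⊤-homo = begin
    ⟦ ⊤ ⟧                        ≡⟨ ⟦⟧-cong (∨-complementʳ ⊤) ⟨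
    ⟦ ⊤ ∨ ¬ ⊤ ⟧                  ≡⟨ ∨-homo ⊤ (¬ ⊤) ⟩
    ⟦ ⊤ ⟧ Bool.∨ ⟦ ¬ ⊤ ⟧         ≡⟨ ≡.cong (⟦ ⊤ ⟧ Bool.∨_) (¬-homo ⊤) ⟩
    ⟦ ⊤ ⟧ Bool.∨ not ⟦ ⊤ ⟧       ≡⟨ BooleanAlgebra.∨-complementʳ 𝔸₂ ⟦ ⊤ ⟧ ⟩
    true                         ∎
    where open ≡.≡-Reasoning

T-injective : ∀ {a b} → (T a → T b) → (T b → T a) → a ≡ b
T-injective a⇒b b⇒a =
  ⇔→≡ (mk⇔ (to T-≡ ∘ a⇒b ∘ from T-≡) (to T-≡ ∘ b⇒a ∘ from T-≡))
  where open Equivalence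

-- Prime filters and separation of elements

module PrimeFilter {ℓ} (choice : AxiomOfChoice ℓ) (𝓐 : BooleanAlgebra ℓ ℓ) where
  open BooleanAlgebra 𝓐
  open BooleanAlgebraProperties 𝓐 using (∧-identityʳ; ∨-identityʳ; ∧-zeroʳ)
  open OrderLattice.Lattice (LatticeProperties.∨-∧-orderTheoreticLattice lattice)
    using (_≤_; x∧y≤x; x∧y≤y; ∧-greatest; y≤x∨y)
    renaming (refl to ≤-refl; trans to ≤-trans; reflexive to ≤-reflexive; antisym to ≤-antisym)
  private
    em : ExcludedMiddle ℓ
    em = choice⇒excludedMiddle choice

  ≤⊥⇒≈⊥ : ∀ {x} → x ≤ ⊥ → x ≈ ⊥
  -- `x ≤ y` unfolds to `x ≈ x ∧ y`, so inequalities are used as equations here and below.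
  ≤⊥⇒≈⊥ x≤⊥ = trans x≤⊥ (∧-zeroʳ _)

  x∧¬y≤⊥⇒x≤y : ∀ {x y} → x ∧ ¬ y ≤ ⊥ → x ≤ y
  x∧¬y≤⊥⇒x≤y {x} {y} x∧¬y≤⊥ = begin
    x                    ≈⟨ ∧-identityʳ x ⟨
    x ∧ ⊤                ≈⟨ ∧-congˡ (∨-complementʳ y) ⟨
    x ∧ (y ∨ ¬ y)        ≈⟨ ∧-distribˡ-∨ x y (¬ y) ⟩
    (x ∧ y) ∨ (x ∧ ¬ y)  ≈⟨ ∨-congˡ (≤⊥⇒≈⊥ x∧¬y≤⊥) ⟩
    (x ∧ y) ∨ ⊥          ≈⟨ ∨-identityʳ (x ∧ y) ⟩
    x ∧ y                ∎
    where open import Relation.Binary.Reasoning.Setoid setoid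

  module _ {c : Carrier} (c≉⊥ : Nullary.¬ (c ≈ ⊥)) where

    -- Containing `c` is built in, so that the homomorphism of a maximal filter sends `c` to `true`.
    record ProperFilter : Set ℓ where
      field
        member   : Carrier → Bool
        contains : T (member c)
        upward   : ∀ {x y} → x ≤ y → T (member x) → T (member y)
        meet     : ∀ {x y} → T (member x) → T (member y) → T (member (x ∧ y))
        proper   : Nullary.¬ T (member ⊥)

    infix 4 _∈_ _⊑_
    _∈_ : Carrier → ProperFilter → Set
    x ∈ F = T (ProperFilter.member F x)

    _⊑_ : ProperFilter → ProperFilter → Set ℓ
    F ⊑ G = ∀ {x} → x ∈ F → x ∈ G

    filterPoset : Poset ℓ ℓ ℓ
    filterPoset = SymInterior.poset {R = _⊑_} id (λ F⊑G G⊑H → G⊑H ∘ F⊑G)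

    open Zorn choice filterPoset

    filters-complete : ChainComplete
    filters-complete D chain = record
      { sup   = record
        { member   = λ x → isYes (em {x ∈⋃})
        ; contains = fromWitness (inj₁ ≤-refl)
        ; upward   = λ x≤y → fromWitness ∘ ⋃-upward x≤y ∘ toWitness
        ; meet     = λ x∈ y∈ → fromWitness (⋃-meet (toWitness x∈) (toWitness y∈))
        ; proper   = ⋃-proper ∘ toWitness
        }
      ; upper = λ F∈D x∈F → fromWitness (inj₂ (_ , F∈D , x∈F))
      ; least = λ {G} D⊑G → [ (λ c≤x → upward G c≤x (contains G))
                            , (λ (F , F∈D , x∈F) → D⊑G F∈D x∈F) ]′ ∘ toWitness
      }
      where
      open ProperFilter

      -- The first summand only matters when D is empty.
      _∈⋃ : Carrier → Set ℓ
      x ∈⋃ = c ≤ x ⊎ ∃ λ F → T (D F) × x ∈ F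

      ⋃-upward : ∀ {x y} → x ≤ y → x ∈⋃ → y ∈⋃
      ⋃-upward x≤y (inj₁ c≤x)             = inj₁ (≤-trans c≤x x≤y)
      ⋃-upward x≤y (inj₂ (F , F∈D , x∈F)) = inj₂ (F , F∈D , upward F x≤y x∈F)

      ⋃-meet : ∀ {x y} → x ∈⋃ → y ∈⋃ → (x ∧ y) ∈⋃
      ⋃-meet (inj₁ c≤x) (inj₁ c≤y) = inj₁ (∧-greatest c≤x c≤y)
      ⋃-meet (inj₁ c≤x) (inj₂ (G , G∈D , y∈G)) =
        inj₂ (G , G∈D , meet G (upward G c≤x (contains G)) y∈G)
      ⋃-meet (inj₂ (F , F∈D , x∈F)) (inj₁ c≤y) =
        inj₂ (F , F∈D , meet F x∈F (upward F c≤y (contains F)))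
      -- The larger of the two filters contains both elements.
      ⋃-meet (inj₂ (F , F∈D , x∈F)) (inj₂ (G , G∈D , y∈G)) with chain F G F∈D G∈D
      ... | inj₁ F⊑G = inj₂ (G , G∈D , meet G (F⊑G x∈F) y∈G)
      ... | inj₂ G⊑F = inj₂ (F , F∈D , meet F x∈F (G⊑F y∈G))

      ⋃-proper : Nullary.¬ (⊥ ∈⋃)
      ⋃-proper (inj₁ c≤⊥)           = c≉⊥ (≤⊥⇒≈⊥ c≤⊥)
      ⋃-proper (inj₂ (F , _ , ⊥∈F)) = proper F ⊥∈F

    -- The filter generated by F and a.
    extend : ∀ F a → Nullary.¬ (¬ a ∈ F) → ProperFilter
    extend F a ¬a∉F = record
      -- `f ∧ a ≤ x` is equivalent to `f ≤ ¬ a ∨ x`, so membership needs no existential quantifier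
      -- over `F`.
      { member   = λ x → member (¬ a ∨ x)
      ; contains = upward (y≤x∨y _ _) contains
      ; upward   = λ x≤y → upward (∨-monoʳ x≤y)
      ; meet     = λ x∈ y∈ →
          upward (≤-reflexive (sym (∨-distribˡ-∧ _ _ _))) (meet x∈ y∈)
      ; proper   = ¬a∉F ∘ upward (≤-reflexive (∨-identityʳ _))
      }
      where
      open ProperFilter F
      ∨-monoʳ : ∀ {x y} → x ≤ y → ¬ a ∨ x ≤ ¬ a ∨ y
      ∨-monoʳ {x} {y} x≤y = trans (∨-congˡ x≤y) (∨-distribˡ-∧ (¬ a) x y)

    -- If `¬ a` is not in `F`, then `extend` gives a proper filter that includes `F` and contains
    -- `a`; maximality puts `a` into `F`.
    maximal⇒ultra : ∀ {F} → Maximal F → ∀ a → a ∈ F ⊎ ¬ a ∈ F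
    maximal⇒ultra {F} maximal a with em {Lift ℓ (¬ a ∈ F)}
    ... | yes (lift ¬a∈F) = inj₂ ¬a∈F
    ... | no ¬a∉F = inj₁ (maximal (extend F a (¬a∉F ∘ lift)) (upward (y≤x∨y _ _))
            (upward c≤¬a∨a contains))
      where
      open ProperFilter F
      c≤¬a∨a : c ≤ ¬ a ∨ a
      c≤¬a∨a = sym (trans (∧-congˡ (∨-complementˡ a)) (∧-identityʳ c))

    -- The meet law holds for every filter; properness and maximality enter in the complement law.
    maximal⇒hom : ∀ {F} → Maximal F → BooleanHom 𝓐
    maximal⇒hom {F} maximal = record
      { ⟦_⟧     = member
      ; ⟦⟧-cong = λ x≈y → T-injective (upward (≤-reflexive x≈y))
                                      (upward (≤-reflexive (sym x≈y)))
      ; ∧-homo  = λ x y → T-injective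
          (λ x∧y∈F → Equivalence.from T-∧
            (upward (x∧y≤x x y) x∧y∈F , upward (x∧y≤y x y) x∧y∈F))
          (λ both → let x∈F , y∈F = Equivalence.to T-∧ both in meet x∈F y∈F)
      ; ¬-homo  = λ x → complement x (maximal⇒ultra {F} maximal x)
      }
      where
      open ProperFilter F
      disjoint : ∀ x → x ∈ F → Nullary.¬ (¬ x ∈ F)
      disjoint x x∈F ¬x∈F = proper (upward (≤-reflexive (∧-complementʳ x)) (meet x∈F ¬x∈F))

      complement : ∀ x → x ∈ F ⊎ ¬ x ∈ F → member (¬ x) ≡ not (member x)
      complement x x∈F⊎¬x∈F with member x | member (¬ x) | disjoint x | x∈F⊎¬x∈F
      ... | true  | true  | excl | _      = ⊥-elim (excl _ _)
      ... | true  | false | _    | _      = ≡.refl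
      ... | false | true  | _    | _      = ≡.refl
      ... | false | false | _    | inj₁ ()
      ... | false | false | _    | inj₂ ()

    primeFilter : ∃ λ (h : BooleanHom 𝓐) → T (BooleanHom.⟦_⟧ h c)
    primeFilter with zorn filters-complete
    ... | F , maximal = maximal⇒hom {F} maximal , ProperFilter.contains F

  Indistinguishable : Carrier → Carrier → Set ℓ
  Indistinguishable x y = ∀ (h : BooleanHom 𝓐) → let open BooleanHom h in ⟦ x ⟧ ≡ ⟦ y ⟧

  -- If `x ≤ y` fails, then `x ∧ ¬ y` is not `⊥`, so some homomorphism sends it to `true`; agreement
  -- on `x` and `y` forces `false`.
  homs-separate : ∀ {x y} → Indistinguishable x y → x ≈ y
  homs-separate agree = ≤-antisym (agree⇒≤ agree) (agree⇒≤ (≡.sym ∘ agree))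
    where
    agree⇒≤ : ∀ {x y} → Indistinguishable x y → x ≤ y
    agree⇒≤ {x} {y} agree = decidable-stable em λ x≰y →
      let h , x∧¬y∈ = primeFilter (x≰y ∘ x∧¬y≤⊥⇒x≤y ∘ ≤-reflexive)
          open BooleanHom h
          x∧¬y≡false = begin
            ⟦ x ∧ ¬ y ⟧               ≡⟨ ∧-homo x (¬ y) ⟩
            ⟦ x ⟧ Bool.∧ ⟦ ¬ y ⟧      ≡⟨ ≡.cong₂ Bool._∧_ (agree h) (¬-homo y) ⟩
            ⟦ y ⟧ Bool.∧ not ⟦ y ⟧    ≡⟨ BooleanAlgebra.∧-complementʳ 𝔸₂ ⟦ y ⟧ ⟩
            false                     ∎
      in ≡.subst T x∧¬y≡false x∧¬y∈
      where open ≡.≡-Reasoning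

-- Boolean homomorphisms acting on triples

module Coordinatewise {ℓ} {𝓐 : BooleanAlgebra ℓ ℓ} (h : BooleanHom 𝓐) where
  open BooleanAlgebra 𝓐
  open BooleanHom h
  private
    module S = Swap 𝓐
    module S₂ = Swap 𝔸₂
  open S using (_₁; _₂; _₃)

  ⟦_⟧₃ : S.Triple → S₂.Triple
  ⟦ z ⟧₃ = ⟦ z ₁ ⟧ , ⟦ z ₂ ⟧ , ⟦ z ₃ ⟧

  ⟦⟧₃-cong : ∀ {z w} → z S.≈₃ w → ⟦ z ⟧₃ S₂.≈₃ ⟦ w ⟧₃
  ⟦⟧₃-cong (p , q , r) = ⟦⟧-cong p , ⟦⟧-cong q , ⟦⟧-cong r

  ¬∧-homo : ∀ x y → ⟦ ¬ (x ∧ y) ⟧ ≡ not (⟦ x ⟧ Bool.∧ ⟦ y ⟧)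
  ¬∧-homo x y = ≡.trans (¬-homo (x ∧ y)) (≡.cong not (∧-homo x y))

  ⟦⟧₃-Bciw : ∀ {z} → S.Bciw z → S₂.Bciw ⟦ z ⟧₃
  ⟦⟧₃-Bciw (p , q) =
    ≡.trans (≡.sym (∨-homo _ _)) (≡.trans (⟦⟧-cong p) ⊤-homo) ,
    ≡.trans (⟦⟧-cong q) (¬∧-homo _ _)

  -- Every bound is a system of Boolean equations, the inequality for `neg` included.
  ⟦⟧₃-Bound : ∀ c zs {u} → S.Bound c zs u → S₂.Bound c (map ⟦_⟧₃ zs) ⟦ u ⟧₃
  ⟦⟧₃-Bound and  (z ∷ w ∷ []) b = ≡.trans (⟦⟧-cong b) (∧-homo _ _)
  ⟦⟧₃-Bound or   (z ∷ w ∷ []) b = ≡.trans (⟦⟧-cong b) (∨-homo _ _)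
  ⟦⟧₃-Bound imp  (z ∷ w ∷ []) b = ≡.trans (⟦⟧-cong b)
    (≡.trans (∨-homo _ _) (≡.cong (Bool._∨ _) (¬-homo _)))
  ⟦⟧₃-Bound neg  (z ∷ [])     (b , b′) =
    ⟦⟧-cong b , ≡.trans (⟦⟧-cong b′) (∧-homo _ _)
  ⟦⟧₃-Bound circ (z ∷ [])     (b , b′ , b″) =
    ≡.trans (⟦⟧-cong b) (¬∧-homo _ _) ,
    ≡.trans (⟦⟧-cong b′) (∧-homo _ _) ,
    ≡.trans (⟦⟧-cong b″) ⊤-homo

-- The monomorphism into the product

injective⇒mono : ∀ {ℓ} {A B : Multialgebra ℓ} (f : Hom A B) →
  (∀ {x y} → Multialgebra._≈_ B (Hom.to f x) (Hom.to f y) → Multialgebra._≈_ A x y) →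
  IsMono f
injective⇒mono f injective g h f∘g≈f∘h x = injective (f∘g≈f∘h x)

theorem8p22 : ∀ {ℓ} → AxiomOfChoice ℓ →
    (𝓐 : BooleanAlgebra ℓ ℓ) (𝓑 : SwapStructure 𝓐) →
    ∃ λ (I : Set ℓ) →
      Σ (Hom (multialgebra 𝓑) (∏ I λ _ → multialgebra (fullSwapStructure 𝔸₂))) λ ĥ →
        IsMono ĥ
theorem8p22 choice 𝓐 𝓑 = BooleanHom 𝓐 , ĥ , λ {C} → injective⇒mono ĥ (λ {z w} → injective {z} {w}) {C}
  where
  open PrimeFilter choice 𝓐 using (homs-separate)
  open Coordinatewise
  open SwapStructure 𝓑 using (Domain⊆Bciw; op⊆)

  module 𝓑 = Multialgebra (multialgebra 𝓑)
  module Π = Multialgebra (∏ (BooleanHom 𝓐) λ _ → multialgebra (fullSwapStructure 𝔸₂))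

  to : 𝓑.Carrier → Π.Carrier
  to (z , z∈B) h = ⟦ h ⟧₃ z , ⟦⟧₃-Bciw h (Domain⊆Bciw z∈B)

  coordinates : ∀ h {n} (zs : Vec 𝓑.Carrier n) →
    map ⟦ h ⟧₃ (map proj₁ zs) ≡ map proj₁ (map (λ z → z h) (map to zs))
  coordinates h zs = begin
    map ⟦ h ⟧₃ (map proj₁ zs)                  ≡⟨ map-∘ ⟦ h ⟧₃ proj₁ zs ⟨
    map (⟦ h ⟧₃ ∘ proj₁) zs                    ≡⟨ map-∘ proj₁ (λ z → to z h) zs ⟩
    map proj₁ (map (λ z → to z h) zs)          ≡⟨ ≡.cong (map proj₁) (map-∘ (λ z → z h) to zs) ⟩
    map proj₁ (map (λ z → z h) (map to zs))    ∎
    where open ≡.≡-Reasoning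

  ĥ : Hom (multialgebra 𝓑) (∏ (BooleanHom 𝓐) λ _ → multialgebra (fullSwapStructure 𝔸₂))
  ĥ = record
    { func = record
      { to   = to
      ; cong = λ z≈w h → ⟦⟧₃-cong h z≈w
      }
    -- The operations of the full swap structure are the bounds themselves, so the inclusion `op⊆`
    -- is enough.
    ; preserves = λ c zs u∈ h → ≡.subst (λ ws → Swap.Bound 𝔸₂ c ws _)
        (coordinates h zs) (⟦⟧₃-Bound h c (map proj₁ zs) (op⊆ c zs u∈))
    }

  -- For a one-element `𝓐` there are no homomorphisms: the hypothesis is vacuous and all elements of
  -- `𝓑` coincide.
  injective : ∀ {z w} → to z Π.≈ to w → z 𝓑.≈ w
  injective eq =
    homs-separate (proj₁ ∘ eq) ,
    homs-separate (proj₁ ∘ proj₂ ∘ eq) ,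
    homs-separate (proj₂ ∘ proj₂ ∘ eq)
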